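{- For a finite simple graph $G$ the following statements are equivalent: (1) $G$ admits a $\{{}^rP_3,{}^bP_3,{}^{rrb}K_3\}$-free $2$-edge-colouring. (2) $G$ admits a $\{{}^rP_3,{}^bP_3,{}^{rbb}K_3\}$-free $2$-edge-colouring. (3) $G$ is a skew-augmentation of the line graph of a bipartite multigraph.
   Context: Graphs are finite and simple unless called multigraphs (which may have parallel edges, no loops). A $2$-edge-colouring of $G$ assigns to every edge the colour red or blue (not necessarily properly). For a set $\mathcal F$ of $2$-edge-coloured graphs, a $2$-edge-colouring of $G$ is $\mathcal F$-free if no induced $2$-edge-coloured subgraph is isomorphic (preserving colours) to a member of $\mathcal F$. Patterns on three vertices: ${}^rP_3$ (resp. ${}^bP_3$) is the path on three vertices with both edges red (resp. blue); ${}^{rrb}K_3$ is the triangle with two red and one blue edge; ${}^{rbb}K_3$ is the triangle with one red and two blue edges. The line graph of a multigraph $H$ is the simple graph with vertex set $E(H)$, two distinct edges being adjacent iff they share at least one endpoint (so parallel edges are adjacent). Augmentations: an edge of a graph is flat if it lies in no triangle. Let $xy$ be a flat edge of a graph $G_0$ and let $B=(A,C)$ be a co-bipartite graph disjoint from $G_0$ whose vertex set is partitioned into cliques $A$ and $C$, with at least one edge between $A$ and $C$. Augmenting $G_0$ along $xy$ with augment $B$ means taking the disjoint union of $G_0-\{x,y\}$ and $B$ and adding all edges between $A$ and $N(x)\setminus\{y\}$ and all edges between $C$ and $N(y)\setminus\{x\}$. An augmentation of $G_0$ is a graph obtained by choosing a (possibly empty) matching $x_1y_1,\dots,x_ky_k$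 of flat edges of $G_0$ and co-bipartite graphs $B_i=(A_i,C_i)$ with at least one $A_iC_i$-edge, and augmenting each $x_iy_i$ with augment $B_i$ (the order is irrelevant). If $G_0$ is the line graph of a bipartite multigraph $H(X,Y)$ and the matching is $e_1f_1,\dots,e_kf_k$ (so the $e_i,f_i$ are edges of $H$), the augmentation is an $X$-augmentation (resp. $Y$-augmentation) if for each $i$ there is a vertex of $X$ (resp. of $Y$) incident in $H$ with both $e_i$ and $f_i$; it is a skew-augmentation if it is an $X$-augmentation or a $Y$-augmentation. -}

module Defs where

open import Data.Fin using (Fin; zero; suc; toℕ; _≟_)
open import Data.Fin.Properties using (any?)
open import Data.List using (List)
open import Data.List.Relation.Unary.All using (All)
open import Data.Nat using (ℕ; ∣_-_∣)
import Data.Nat.Properties as ℕ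
open import Data.Product using (Σ-syntax; ∃-syntax; _×_; _,_; proj₁; proj₂)
open import Data.Refinement using (Refinement-syntax; value)
open import Data.Sum using (_⊎_; inj₁; inj₂)
open import Function.Base using (_∘_)
open import Function.Bundles using (_⇔_; _↔_; Equivalence; Inverse)
open import Function.Definitions using (Injective)
open import Level using (0ℓ)
open import Relation.Binary using (Rel; Symmetric; Irreflexive; Decidable)
open import Relation.Binary.PropositionalEquality
  using (_≡_; _≢_; refl; sym; trans)
open import Relation.Nullary using (yes; no; ¬_; ¬?; contradiction)
open import Relation.Nullary.Decidable using (map′; _×-dec_; _⊎-dec_)

------------------------------------------------------------------------
-- Simple graphs

-- A finite simple graph on n vertices is a Graph (Fin n).  Adjacency is
-- decidable, as it is for any concretely given finite graph.

record Graph (V : Set) : Set₁ where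
  infix 4 _~_ _~?_
  field
    _~_      : Rel V 0ℓ
    ~-sym    : Symmetric _~_
    ~-irrefl : Irreflexive _≡_ _~_
    _~?_     : Decidable _~_

record _≅_ {V W : Set} (G : Graph V) (H : Graph W) : Set where
  private
    module G = Graph G
    module H = Graph H
  field
    bijection : V ↔ W
  open Inverse bijection using (to)
  field
    adjacency : ∀ u v → u G.~ v ⇔ to u H.~ to v

path : ∀ n → Graph (Fin n)
path n = record
  { _~_      = λ u v → ∣ toℕ u - toℕ v ∣ ≡ 1
  ; ~-sym    = λ {u} {v} → trans (ℕ.∣-∣-comm (toℕ v) (toℕ u))
  ; ~-irrefl = λ { {u} refl p → contradiction (trans (sym (ℕ.∣n-n∣≡0 (toℕ u))) p) λ () }
  ; _~?_     = λ u v → ∣ toℕ u - toℕ v ∣ ℕ.≟ 1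
  }

complete : ∀ n → Graph (Fin n)
complete n = record
  { _~_      = _≢_
  ; ~-sym    = λ u≢v → u≢v ∘ sym
  ; ~-irrefl = λ u≡v u≢v → u≢v u≡v
  ; _~?_     = λ u v → ¬? (u ≟ v)
  }

------------------------------------------------------------------------
-- 2-edge-colourings

data Colour : Set where
  red blue : Colour

-- The adjacency proof is irrelevant, so a pair of adjacent vertices has
-- exactly one colour; non-adjacent pairs have none.

record Colouring {V : Set} (G : Graph V) : Set where
  open Graph G
  field
    colour     : ∀ u v → .(u ~ v) → Colour
    colour-sym : ∀ u v (p : u ~ v) → colour u v p ≡ colour v u (~-sym p)

record ColouredGraph : Set₁ where
  constructor coloured
  field
    {order}   : ℕ
    graph     : Graph (Fin order)
    colouring : Colouring graph

-- F occurs in (G , c) when some induced 2-edge-coloured subgraph of (G , c)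
-- is isomorphic to F, i.e. when F embeds, preserving and reflecting
-- adjacency and preserving colours.

record Occurs (F : ColouredGraph) {V : Set} {G : Graph V} (c : Colouring G) : Set where
  open ColouredGraph F
  private
    module F = Graph graph
    module G = Graph G
    module c = Colouring c
  open Colouring colouring
  field
    embed     : Fin order → V
    injective : Injective _≡_ _≡_ embed
    adjacency : ∀ u v → u F.~ v ⇔ embed u G.~ embed v
    colours   : ∀ u v (p : u F.~ v) →
                c.colour (embed u) (embed v) (Equivalence.to (adjacency u v) p)
                  ≡ colour u v p

Free : List ColouredGraph → {V : Set} {G : Graph V} → Colouring G → Set₁
Free Fs c = All (λ F → ¬ Occurs F c) Fs

AdmitsFree : List ColouredGraph → {V : Set} → Graph V → Set₁
AdmitsFree Fs G = Σ[ c ∈ Colouring G ] Free Fs c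

monochromaticP₃ : Colour → ColouredGraph
monochromaticP₃ k = coloured (path 3) record
  { colour     = λ _ _ _ → k
  ; colour-sym = λ _ _ _ → refl
  }

-- The two edges at vertex zero have colour k, the third edge has colour l.

triangle : Colour → Colour → ColouredGraph
triangle k l = coloured (complete 3) record
  { colour     = λ u v _ → pick u v
  ; colour-sym = λ u v _ → pick-sym u v
  }
  where
  pick : Fin 3 → Fin 3 → Colour
  pick zero    _       = k
  pick (suc _) zero    = k
  pick (suc _) (suc _) = l

  pick-sym : ∀ u v → pick u v ≡ pick v u
  pick-sym zero    zero    = refl
  pick-sym zero    (suc _) = refl
  pick-sym (suc _) zero    = refl
  pick-sym (suc _) (suc _) = refl

ʳP₃ ᵇP₃ ʳʳᵇK₃ ʳᵇᵇK₃ : ColouredGraph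
ʳP₃   = monochromaticP₃ red
ᵇP₃   = monochromaticP₃ blue
ʳʳᵇK₃ = triangle red blue
ʳᵇᵇK₃ = triangle blue red

------------------------------------------------------------------------
-- Multigraphs and line graphs

-- The order of the two ends of an edge carries no meaning.

record Multigraph : Set where
  field
    order size : ℕ
    ends       : Fin size → Fin order × Fin order
    loopless   : ∀ e → proj₁ (ends e) ≢ proj₂ (ends e)

  Incident : Fin order → Fin size → Set
  Incident v e = v ≡ proj₁ (ends e) ⊎ v ≡ proj₂ (ends e)

  incident? : Decidable Incident
  incident? v e = (v ≟ proj₁ (ends e)) ⊎-dec (v ≟ proj₂ (ends e))

lineGraph : (H : Multigraph) → Graph (Fin (Multigraph.size H))
lineGraph H = record
  { _~_      = λ e f → e ≢ f × ∃[ v ] (Incident v e × Incident v f)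
  ; ~-sym    = λ (e≢f , v , p , q) → e≢f ∘ sym , v , q , p
  ; ~-irrefl = λ e≡f (e≢f , _) → e≢f e≡f
  ; _~?_     = λ e f → ¬? (e ≟ f) ×-dec any? λ v → incident? v e ×-dec incident? v f
  }
  where open Multigraph H

data Class : Set where
  X Y : Class

record BipartiteMultigraph : Set where
  field
    multigraph : Multigraph
  open Multigraph multigraph public
  field
    class     : Fin order → Class
    bipartite : ∀ e → class (proj₁ (ends e)) ≢ class (proj₂ (ends e))

------------------------------------------------------------------------
-- Augmentations

Flat : {V : Set} → Graph V → V → V → Set
Flat G x y = x ~ y × (∀ z → ¬ (x ~ z × y ~ z))
  where open Graph G

data Side : Set where
  A C : Side

record Augment : Set₁ where
  field
    {order} : ℕ
    graph   : Graph (Fin order)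
    side    : Fin order → Side
  open Graph graph public
  field
    cliques   : ∀ u v → side u ≡ side v → u ≢ v → u ~ v
    crossEdge : ∃[ a ] ∃[ c ] (side a ≡ A × side c ≡ C × a ~ c)

-- The edge x y is listed as end i A = x, end i C = y: the end that gets
-- replaced by the clique A, respectively C.

record Augmentation {V : Set} (G₀ : Graph V) : Set₁ where
  field
    k        : ℕ
    end      : Fin k → Side → V
    flat     : ∀ i → Flat G₀ (end i A) (end i C)
    matching : ∀ i j s t → end i s ≡ end j t → i ≡ j
    augment  : Fin k → Augment

  module B (i : Fin k) = Augment (augment i)

  Unmatched : V → Set
  Unmatched v = ∀ i s → v ≢ end i s

  -- Proofs of Unmatched are irrelevant, so each unmatched vertex of G₀
  -- yields exactly one vertex here.

  Vertex : Set
  Vertex = [ v ∈ V ∣ Unmatched v ] ⊎ (Σ[ i ∈ Fin k ] Fin (B.order i))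

module _ {V : Set} {G₀ : Graph V} (M : Augmentation G₀) where
  open Graph G₀
  open Augmentation M

  -- All edges are augmented at once.  If x_j is a neighbour of x_i, then
  -- augmenting x_j y_j replaces x_j by A_j in the neighbourhood of x_i, and
  -- augmenting x_i y_i then joins A_i completely to A_j; this is B-B.
  -- The exclusion of y_i from N(x_i) is automatic in G₀-B and B-B, since y_i
  -- is neither unmatched nor the end of another matching edge.

  data Adjacent : Rel Vertex 0ℓ where
    G₀-G₀ : ∀ {u v} → value u ~ value v → Adjacent (inj₁ u) (inj₁ v)
    G₀-B  : ∀ {u i b} → value u ~ end i (B.side i b) → Adjacent (inj₁ u) (inj₂ (i , b))
    B-G₀  : ∀ {i b v} → end i (B.side i b) ~ value v → Adjacent (inj₂ (i , b)) (inj₁ v)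
    B     : ∀ {i b c} → B._~_ i b c → Adjacent (inj₂ (i , b)) (inj₂ (i , c))
    B-B   : ∀ {i j b c} → i ≢ j → end i (B.side i b) ~ end j (B.side j c) →
            Adjacent (inj₂ (i , b)) (inj₂ (j , c))

  private
    adjacent-sym : Symmetric Adjacent
    adjacent-sym (G₀-G₀ p)   = G₀-G₀ (~-sym p)
    adjacent-sym (G₀-B p)    = B-G₀ (~-sym p)
    adjacent-sym (B-G₀ p)    = G₀-B (~-sym p)
    adjacent-sym (B {i} p)   = B (B.~-sym i p)
    adjacent-sym (B-B i≢j p) = B-B (i≢j ∘ sym) (~-sym p)

    adjacent-irrefl : Irreflexive _≡_ Adjacent
    adjacent-irrefl refl (G₀-G₀ p)   = ~-irrefl refl p
    adjacent-irrefl refl (B {i} p)   = B.~-irrefl i refl p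
    adjacent-irrefl refl (B-B i≢i _) = i≢i refl

    adjacent? : Decidable Adjacent
    adjacent? (inj₁ u) (inj₁ v) =
      map′ G₀-G₀ (λ { (G₀-G₀ p) → p }) (value u ~? value v)
    adjacent? (inj₁ u) (inj₂ (i , b)) =
      map′ G₀-B (λ { (G₀-B p) → p }) (value u ~? end i (B.side i b))
    adjacent? (inj₂ (i , b)) (inj₁ v) =
      map′ B-G₀ (λ { (B-G₀ p) → p }) (end i (B.side i b) ~? value v)
    adjacent? (inj₂ (i , b)) (inj₂ (j , c)) with i ≟ j
    ... | yes refl = map′ B (λ { (B p) → p ; (B-B i≢i _) → contradiction refl i≢i })
                       (B._~?_ i b c)
    ... | no i≢j   = map′ (B-B i≢j) (λ { (B _) → contradiction refl i≢j ; (B-B _ p) → p })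
                       (end i (B.side i b) ~? end j (B.side j c))

  augmented : Graph Vertex
  augmented = record
    { _~_      = Adjacent
    ; ~-sym    = adjacent-sym
    ; ~-irrefl = adjacent-irrefl
    ; _~?_     = adjacent?
    }

module _ (H : BipartiteMultigraph) where
  open BipartiteMultigraph H

  ClassAugmentation : Class → Augmentation (lineGraph multigraph) → Set
  ClassAugmentation κ M =
    ∀ i → ∃[ v ] (class v ≡ κ × Incident v (end i A) × Incident v (end i C))
    where open Augmentation M

  Skew : Augmentation (lineGraph multigraph) → Set
  Skew M = ClassAugmentation X M ⊎ ClassAugmentation Y M

IsSkewAugmentation : {V : Set} → Graph V → Set₁
IsSkewAugmentation G =
  Σ[ H ∈ BipartiteMultigraph ]
  Σ[ M ∈ Augmentation (lineGraph (BipartiteMultigraph.multigraph H)) ]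
    (Skew H M × G ≅ augmented M)

-- Swapping the two colours exchanges (1) and (2).  A colouring as in (2) is
-- one in which "equal or joined by a blue edge" is an equivalence relation
-- and any two red neighbours of a vertex are adjacent.
--
-- (3) ⇒ (2): in a κ-augmentation, colour a pair blue if the edges of H which
-- its two vertices replace meet outside κ, except that pairs between the two
-- cliques of an augment are red.
--
-- (2) ⇒ (3): the blue cliques become the Y-vertices of H.  A red component
-- containing a red triangle is a clique of G and becomes an X-vertex.  Any
-- other vertex with red neighbours has all of them in a single blue clique;
-- the vertices outside the red triangles with red neighbours across a given
-- pair {α, β} of blue cliques form a co-bipartite graph, which is contracted
-- to a flat edge whose two ends share an X-vertex of H and no Y-vertex.

module Submission where

open import Defs
open import Data.Fin
  using (Fin; zero; suc; _≟_; _<_; _<?_; _↑ˡ_; _↑ʳ_; splitAt; join; remQuot; combine)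
open import Data.Fin.Patterns using (0F; 1F; 2F)
open import Data.Fin.Properties
  using (any?; suc-injective; ↑ˡ-injective; ↑ʳ-injective; splitAt-↑ˡ; splitAt-↑ʳ;
         <⇒≢; <-cmp; <-asym; remQuot-combine; +↔⊎; *↔×)
open import Data.Irrelevant using ([_])
open import Data.List using ([]; _∷_)
open import Data.List.Relation.Unary.All using ([]; _∷_)
open import Data.Nat as ℕ using (ℕ)
open import Data.Product using (_×_; _,_; Σ-syntax; ∃; ∃-syntax; proj₁; proj₂)
open import Data.Product.Function.NonDependent.Propositional using (_×-↔_)
open import Data.Refinement using (Refinement-syntax; value) renaming (_,_ to _,ʳ_)
open import Data.Refinement.Properties using (value-injective)
open import Data.Sum as Sum using (_⊎_; inj₁; inj₂; [_,_]′)
open import Data.Sum.Function.Propositional using (_⊎-↔_)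
open import Data.Sum.Properties using (inj₁-injective; inj₂-injective)
open import Function.Base using (_∘_; case_of_; id; const)
open import Function.Bundles
  using (_⇔_; _↔_; mk⇔; mk↔ₛ′; Equivalence; Inverse; Injection)
open import Function.Construct.Identity using (↔-id)
open import Function.Properties.Inverse using (↔⇒↣; ↔-trans; ↔-sym)
open import Level using (0ℓ)
open import Relation.Binary
  using (Rel; Decidable; DecidableEquality; IsDecEquivalence; tri<; tri≈; tri>)
open import Relation.Binary.PropositionalEquality
  using (_≡_; _≢_; refl; sym; trans; cong; cong₂; subst; subst₂; ≢-sym)
open import Relation.Nullary using (Dec; yes; no; ¬_; ¬?; contradiction)
open import Relation.Nullary.Decidable using (_×-dec_; _⊎-dec_)
open import Relation.Nullary.Negation using (contradiction-irr)
import Relation.Unary as U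

private
  variable
    V : Set
    G : Graph V
    k l : Colour
    n : ℕ

-- Coloured edges and forbidden patterns as closure rules.

opposite : Colour → Colour
opposite red  = blue
opposite blue = red

opposite-involutive : ∀ k → opposite (opposite k) ≡ k
opposite-involutive red  = refl
opposite-involutive blue = refl

infix 4 _≟ᶜ_
_≟ᶜ_ : DecidableEquality Colour
red  ≟ᶜ red  = yes refl
red  ≟ᶜ blue = no λ ()
blue ≟ᶜ red  = no λ ()
blue ≟ᶜ blue = yes refl

module _ {G : Graph V} (c : Colouring G) where
  open Graph G
  open Colouring c

  Edge : Colour → V → V → Set
  Edge k u v = Σ[ p ∈ u ~ v ] colour u v p ≡ k

  Edge-sym : ∀ {u v} → Edge k u v → Edge k v u
  Edge-sym {u = u} {v} (p , q) = ~-sym p , trans (sym (colour-sym u v p)) q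

  Edge⇒≢ : ∀ {u v} → Edge k u v → u ≢ v
  Edge⇒≢ (p , _) u≡v = ~-irrefl u≡v p

  edge? : ∀ k → Decidable (Edge k)
  edge? k u v with u ~? v
  ... | no u≁v = no (u≁v ∘ proj₁)
  ... | yes p with colour u v p ≟ᶜ k
  ...   | yes q = yes (p , q)
  ...   | no ¬q = no λ (_ , q) → ¬q q

  Edge-opposite : ∀ {u v} → Edge k u v → ¬ Edge (opposite k) u v
  Edge-opposite {red}  (_ , p) (_ , q) = case trans (sym p) q of λ ()
  Edge-opposite {blue} (_ , p) (_ , q) = case trans (sym p) q of λ ()

  edge-either : ∀ k {u v} → u ~ v → Edge k u v ⊎ Edge (opposite k) u v
  edge-either k {u} {v} p = Sum.map (p ,_) (p ,_) (either k (colour u v p))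
    where
    either : ∀ k l → l ≡ k ⊎ l ≡ opposite k
    either red  red  = inj₁ refl
    either red  blue = inj₂ refl
    either blue red  = inj₂ refl
    either blue blue = inj₁ refl

-- The parameter `k` is the repeated colour of the forbidden triangle, so `Good red` stands for (1)
-- and `Good blue` for (2).
record Good (k : Colour) {G : Graph V} (c : Colouring G) : Set where
  open Graph G
  field
    P₃-free : ∀ l {u v w} → Edge c l u v → Edge c l v w → u ≢ w → u ~ w
    K₃-free : ∀ {u v w} → Edge c k u v → Edge c k v w → ¬ Edge c (opposite k) u w

module _ {G : Graph V} (c : Colouring G) where
  open Graph G
  open Colouring c

  private
    three : V → V → V → Fin 3 → V
    three u v w 0F = u
    three u v w 1F = v
    three u v w 2F = w

    three-injective : ∀ {u v w} → u ≢ v → v ≢ w → u ≢ w →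
                      ∀ {i j} → three u v w i ≡ three u v w j → i ≡ j
    three-injective a b d {0F} {0F} _ = refl
    three-injective a b d {0F} {1F} p = contradiction p a
    three-injective a b d {0F} {2F} p = contradiction p d
    three-injective a b d {1F} {0F} p = contradiction (sym p) a
    three-injective a b d {1F} {1F} _ = refl
    three-injective a b d {1F} {2F} p = contradiction p b
    three-injective a b d {2F} {0F} p = contradiction (sym p) d
    three-injective a b d {2F} {1F} p = contradiction (sym p) b
    three-injective a b d {2F} {2F} _ = refl

  ¬monochromaticP₃⇔ : (¬ Occurs (monochromaticP₃ k) c) ⇔
                      (∀ {u v w} → Edge c k u v → Edge c k v w → u ≢ w → u ~ w)
  ¬monochromaticP₃⇔ {k} = mk⇔ closed free
    where
    closed : ¬ Occurs (monochromaticP₃ k) c →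
             ∀ {u v w} → Edge c k u v → Edge c k v w → u ≢ w → u ~ w
    closed ¬occ {u} {v} {w} uv@(p , p′) vw@(q , q′) u≢w with u ~? w
    ... | yes u~w = u~w
    ... | no  u≁w = contradiction record
      { embed     = three u v w
      ; injective = three-injective (Edge⇒≢ c uv) (Edge⇒≢ c vw) u≢w
      ; adjacency = adj
      ; colours   = col
      } ¬occ
      where
      adj : ∀ i j → Graph._~_ (path 3) i j ⇔ three u v w i ~ three u v w j
      adj 0F 0F = mk⇔ (λ ()) (λ r → contradiction r (~-irrefl refl))
      adj 0F 1F = mk⇔ (λ _ → p) (λ _ → refl)
      adj 0F 2F = mk⇔ (λ ()) (λ r → contradiction r u≁w)
      adj 1F 0F = mk⇔ (λ _ → ~-sym p) (λ _ → refl)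
      adj 1F 1F = mk⇔ (λ ()) (λ r → contradiction r (~-irrefl refl))
      adj 1F 2F = mk⇔ (λ _ → q) (λ _ → refl)
      adj 2F 0F = mk⇔ (λ ()) (λ r → contradiction (~-sym r) u≁w)
      adj 2F 1F = mk⇔ (λ _ → ~-sym q) (λ _ → refl)
      adj 2F 2F = mk⇔ (λ ()) (λ r → contradiction r (~-irrefl refl))

      col : ∀ i j (r : Graph._~_ (path 3) i j) →
            colour (three u v w i) (three u v w j) (Equivalence.to (adj i j) r) ≡ k
      col 0F 1F _ = p′
      col 1F 0F _ = proj₂ (Edge-sym c uv)
      col 1F 2F _ = q′
      col 2F 1F _ = proj₂ (Edge-sym c vw)
      col 2F 2F ()

    free : (∀ {u v w} → Edge c k u v → Edge c k v w → u ≢ w → u ~ w) →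
           ¬ Occurs (monochromaticP₃ k) c
    free closed occ =
      case Equivalence.from (adjacency 0F 2F)
             (closed (edge 0F 1F refl) (edge 1F 2F refl) λ e → case injective e of λ ())
      of λ ()
      where
      open Occurs occ
      edge : ∀ i j → Graph._~_ (path 3) i j → Edge c k (embed i) (embed j)
      edge i j r = Equivalence.to (adjacency i j) r , colours i j r

  ¬triangle⇔ : (¬ Occurs (triangle k l) c) ⇔
               (∀ {u v w} → Edge c k u v → Edge c k v w → ¬ Edge c l u w)
  ¬triangle⇔ {k} {l} = mk⇔ none free
    where
    none : ¬ Occurs (triangle k l) c →
           ∀ {u v w} → Edge c k u v → Edge c k v w → ¬ Edge c l u w
    none ¬occ {u} {v} {w} uv@(p , p′) vw@(q , q′) uw@(r , r′) = ¬occ record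
      -- The two edges of colour `k` meet at vertex `0F` of the pattern, so the middle vertex `v`
      -- comes first.
      { embed     = three v u w
      ; injective = inj
      ; adjacency = adj
      ; colours   = col
      }
      where
      inj : ∀ {i j} → three v u w i ≡ three v u w j → i ≡ j
      inj = three-injective (≢-sym (Edge⇒≢ c uv)) (Edge⇒≢ c uw) (Edge⇒≢ c vw)

      to : ∀ i j → i ≢ j → three v u w i ~ three v u w j
      to 0F 0F i≢j = contradiction refl i≢j
      to 0F 1F _   = ~-sym p
      to 0F 2F _   = q
      to 1F 0F _   = p
      to 1F 1F i≢j = contradiction refl i≢j
      to 1F 2F _   = r
      to 2F 0F _   = ~-sym q
      to 2F 1F _   = ~-sym r
      to 2F 2F i≢j = contradiction refl i≢j

      adj : ∀ i j → i ≢ j ⇔ three v u w i ~ three v u w j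
      adj i j = mk⇔ (to i j) λ s i≡j → ~-irrefl (cong (three v u w) i≡j) s

      col : ∀ i j (s : i ≢ j) → colour (three v u w i) (three v u w j) (to i j s) ≡
              Colouring.colour (ColouredGraph.colouring (triangle k l)) i j s
      col 0F 0F i≢j = contradiction refl i≢j
      col 0F 1F _   = proj₂ (Edge-sym c uv)
      col 0F 2F _   = q′
      col 1F 0F _   = p′
      col 1F 1F i≢j = contradiction refl i≢j
      col 1F 2F _   = r′
      col 2F 0F _   = proj₂ (Edge-sym c vw)
      col 2F 1F _   = proj₂ (Edge-sym c uw)
      col 2F 2F i≢j = contradiction refl i≢j

    free : (∀ {u v w} → Edge c k u v → Edge c k v w → ¬ Edge c l u w) →
           ¬ Occurs (triangle k l) c
    free none occ = none (edge 1F 0F λ ()) (edge 0F 2F λ ()) (edge 1F 2F λ ())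
      where
      open Occurs occ
      edge : ∀ i j (s : i ≢ j) → Edge c _ (embed i) (embed j)
      edge i j s = Equivalence.to (adjacency i j) s , colours i j s

  Free⇔Good : Free (ʳP₃ ∷ ᵇP₃ ∷ triangle k (opposite k) ∷ []) c ⇔ Good k c
  Free⇔Good {k} = mk⇔
    (λ { (¬r ∷ ¬b ∷ ¬t ∷ []) → record
      { P₃-free = λ { red  → Equivalence.to ¬monochromaticP₃⇔ ¬r
                    ; blue → Equivalence.to ¬monochromaticP₃⇔ ¬b }
      ; K₃-free = Equivalence.to ¬triangle⇔ ¬t } })
    (λ g → let open Good g in
      Equivalence.from ¬monochromaticP₃⇔ (P₃-free red) ∷
      Equivalence.from ¬monochromaticP₃⇔ (P₃-free blue) ∷
      Equivalence.from ¬triangle⇔ K₃-free ∷ [])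

AdmitsGood : Colour → Graph V → Set
AdmitsGood k G = Σ[ c ∈ Colouring G ] Good k c

AdmitsFree⇔AdmitsGood : AdmitsFree (ʳP₃ ∷ ᵇP₃ ∷ triangle k (opposite k) ∷ []) G ⇔ AdmitsGood k G
AdmitsFree⇔AdmitsGood = mk⇔
  (λ (c , free) → c , Equivalence.to (Free⇔Good c) free)
  (λ (c , good) → c , Equivalence.from (Free⇔Good c) good)

-- Colour swap and transport along isomorphisms.

swap : Colouring G → Colouring G
swap c = record
  { colour     = λ u v p → opposite (colour u v p)
  ; colour-sym = λ u v p → cong opposite (colour-sym u v p)
  }
  where open Colouring c

swap-Edge : (c : Colouring G) → ∀ {u v} → Edge (swap c) (opposite k) u v → Edge c k u v
swap-Edge c (p , q) =
  p , trans (sym (opposite-involutive _)) (trans (cong opposite q) (opposite-involutive _))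

swap-Good : {c : Colouring G} → Good k c → Good (opposite k) (swap c)
swap-Good {c = c} g = record
  { P₃-free = λ { red  uv vw → P₃-free blue (swap-Edge c uv) (swap-Edge c vw)
                ; blue uv vw → P₃-free red  (swap-Edge c uv) (swap-Edge c vw) }
  ; K₃-free = λ uv vw uw → K₃-free (swap-Edge c uv) (swap-Edge c vw) (swap-Edge c uw)
  }
  where open Good g

AdmitsGood-swap : AdmitsGood k G → AdmitsGood (opposite k) G
AdmitsGood-swap (c , g) = swap c , swap-Good g

pull-Good : {W : Set} {G : Graph V} {H : Graph W} → G ≅ H → AdmitsGood k H → AdmitsGood k G
pull-Good {k = k} {G = G} {H} iso (c , g) = d , record
  { P₃-free = λ l uv vw u≢w → Equivalence.from (adjacency _ _)
                (P₃-free l (push uv) (push vw) (u≢w ∘ Injection.injective (↔⇒↣ bijection)))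
  ; K₃-free = λ uv vw uw → K₃-free (push uv) (push vw) (push uw)
  }
  where
  open _≅_ iso
  open Inverse bijection using (to)
  open Colouring c
  open Good g

  d : Colouring G
  d = record
    { colour     = λ u v p → colour (to u) (to v) (Equivalence.to (adjacency u v) p)
    ; colour-sym = λ u v p → colour-sym (to u) (to v) (Equivalence.to (adjacency u v) p)
    }

  push : ∀ {l u v} → Edge d l u v → Edge c l (to u) (to v)
  push (p , q) = Equivalence.to (adjacency _ _) p , q

-- Line graphs of bipartite multigraphs.

other : Class → Class
other X = Y
other Y = X

infix 4 _≟ᶜˡ_
_≟ᶜˡ_ : DecidableEquality Class
X ≟ᶜˡ X = yes refl
X ≟ᶜˡ Y = no λ ()
Y ≟ᶜˡ X = no λ ()
Y ≟ᶜˡ Y = yes refl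

≢⇒≡other : ∀ {κ μ} → κ ≢ μ → κ ≡ other μ
≢⇒≡other {X} {X} κ≢μ = contradiction refl κ≢μ
≢⇒≡other {X} {Y} _   = refl
≢⇒≡other {Y} {X} _   = refl
≢⇒≡other {Y} {Y} κ≢μ = contradiction refl κ≢μ

module BipartiteLineGraph (H : BipartiteMultigraph) where
  open BipartiteMultigraph H
  open Graph (lineGraph multigraph)

  -- Testing the first end is enough: by `bipartite`, the two ends lie in different classes.
  endIn : Class → Fin size → Fin order
  endIn κ e with class (proj₁ (ends e)) ≟ᶜˡ κ
  ... | yes _ = proj₁ (ends e)
  ... | no  _ = proj₂ (ends e)

  endIn-incident : ∀ κ e → Incident (endIn κ e) e
  endIn-incident κ e with class (proj₁ (ends e)) ≟ᶜˡ κ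
  ... | yes _ = inj₁ refl
  ... | no  _ = inj₂ refl

  incident⇒endIn : ∀ {κ v e} → Incident v e → class v ≡ κ → v ≡ endIn κ e
  incident⇒endIn {κ} {v} {e} inc eq with class (proj₁ (ends e)) ≟ᶜˡ κ | inc
  ... | yes _ | inj₁ p    = p
  ... | yes q | inj₂ refl = contradiction (trans q (sym eq)) (bipartite e)
  ... | no ¬q | inj₁ refl = contradiction eq ¬q
  ... | no _  | inj₂ p    = p

  Meet : Class → Fin size → Fin size → Set
  Meet κ e f = endIn κ e ≡ endIn κ f

  ~⇒Meet : ∀ κ {e f} → e ~ f → Meet κ e f ⊎ Meet (other κ) e f
  ~⇒Meet κ (_ , v , p , q) with class v ≟ᶜˡ κ
  ... | yes eq = inj₁ (trans (sym (incident⇒endIn p eq)) (incident⇒endIn q eq))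
  ... | no ¬eq =
    let eq = ≢⇒≡other ¬eq in inj₂ (trans (sym (incident⇒endIn p eq)) (incident⇒endIn q eq))

  Meet⇒~ : ∀ κ {e f} → e ≢ f → Meet κ e f → e ~ f
  Meet⇒~ κ {e} {f} e≢f m =
    e≢f , endIn κ f , subst (λ v → Incident v e) m (endIn-incident κ e) , endIn-incident κ f

  -- A third edge with the same `κ`-end as both `x` and `y` would form a triangle with them in the
  -- line graph.
  flat⇒end : ∀ κ {x y z} → Flat (lineGraph multigraph) x y →
             Meet κ z x → Meet κ z y → z ≡ x ⊎ z ≡ y
  flat⇒end κ {x} {y} {z} (_ , flat) zx zy with z ≟ x | z ≟ y
  ... | yes p | _     = inj₁ p
  ... | no _  | yes q = inj₂ q
  ... | no ¬p | no ¬q =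
    contradiction (Meet⇒~ κ (¬p ∘ sym) (sym zx) , Meet⇒~ κ (¬q ∘ sym) (sym zy)) (flat z)

-- Colouring a skew-augmentation.

infix 4 _≟ˢ_
_≟ˢ_ : DecidableEquality Side
A ≟ˢ A = yes refl
A ≟ˢ C = no λ ()
C ≟ˢ A = no λ ()
C ≟ˢ C = yes refl

module Base {V : Set} {G₀ : Graph V} (M : Augmentation G₀) where
  open Augmentation M

  base : Vertex → V
  base (inj₁ u)       = value u
  base (inj₂ (i , b)) = end i (B.side i b)

  matched-absurd : {Z : Set} (u : [ v ∈ V ∣ Unmatched v ]) → ∀ i s → value u ≡ end i s → Z
  matched-absurd (e ,ʳ [ unmatched ]) i s p = contradiction-irr (unmatched i s p) λ ()

hue : {P : Set} → Dec P → Colour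
hue (yes _) = blue
hue (no _)  = red

hue-blue : {P : Set} (p? : Dec P) → hue p? ≡ blue → P
hue-blue (yes p) _ = p

hue-red : {P : Set} (p? : Dec P) → hue p? ≡ red → ¬ P
hue-red (no ¬p) _ = ¬p

hue-⇔ : {P Q : Set} (p? : Dec P) (q? : Dec Q) → (P → Q) → (Q → P) → hue p? ≡ hue q?
hue-⇔ (yes _) (yes _) _ _ = refl
hue-⇔ (yes p) (no ¬q) f _ = contradiction (f p) ¬q
hue-⇔ (no ¬p) (yes q) _ g = contradiction (g q) ¬p
hue-⇔ (no _)  (no _)  _ _ = refl

module SkewColouring (H : BipartiteMultigraph)
  (M : Augmentation (lineGraph (BipartiteMultigraph.multigraph H)))
  (κ : Class) (κ-augmentation : ClassAugmentation H κ M) where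

  open BipartiteMultigraph H
  open BipartiteLineGraph H
  open Augmentation M
  open Base M
  private
    module L = Graph (lineGraph multigraph)
    module M = Graph (augmented M)

  -- Over mates, adjacency is decided by the augment; over all other pairs it follows the line
  -- graph.
  Mates : Fin size → Fin size → Set
  Mates e f = ∃[ i ] (e ≡ end i A × f ≡ end i C ⊎ e ≡ end i C × f ≡ end i A)

  mates? : Decidable Mates
  mates? e f = any? λ i →
    ((e ≟ end i A) ×-dec (f ≟ end i C)) ⊎-dec ((e ≟ end i C) ×-dec (f ≟ end i A))

  Mates-sym : ∀ {e f} → Mates e f → Mates f e
  Mates-sym (i , inj₁ (p , q)) = i , inj₂ (q , p)
  Mates-sym (i , inj₂ (p , q)) = i , inj₁ (q , p)

  Mates⇒≢ : ∀ {e f} → Mates e f → e ≢ f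
  Mates⇒≢ (i , inj₁ (refl , refl)) eq = L.~-irrefl eq (proj₁ (flat i))
  Mates⇒≢ (i , inj₂ (refl , refl)) eq = L.~-irrefl (sym eq) (proj₁ (flat i))

  ends⇒Mates : ∀ i {s t} → s ≢ t → Mates (end i s) (end i t)
  ends⇒Mates i {A} {A} s≢t = contradiction refl s≢t
  ends⇒Mates i {A} {C} _   = i , inj₁ (refl , refl)
  ends⇒Mates i {C} {A} _   = i , inj₂ (refl , refl)
  ends⇒Mates i {C} {C} s≢t = contradiction refl s≢t

  -- Skewness enters here: the common end of the two mates lies in `κ` for every augment, which is
  -- what lets the cross pairs be red.
  Mates⇒Meet : ∀ {e f} → Mates e f → Meet κ e f
  Mates⇒Meet (i , m) with κ-augmentation i
  Mates⇒Meet (i , inj₁ (refl , refl)) | v , eq , p , q =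
    trans (sym (incident⇒endIn p eq)) (incident⇒endIn q eq)
  Mates⇒Meet (i , inj₂ (refl , refl)) | v , eq , p , q =
    trans (sym (incident⇒endIn q eq)) (incident⇒endIn p eq)

  -- By flatness, no third edge shares its `μ`-end with both mates, whichever class `μ` is.
  Mates-between : ∀ μ {e f g} → Mates e g → Meet μ e f → Meet μ f g → f ≡ e ⊎ f ≡ g
  Mates-between μ (i , inj₁ (refl , refl)) ef fg = flat⇒end μ (flat i) (sym ef) fg
  Mates-between μ (i , inj₂ (refl , refl)) ef fg = Sum.swap (flat⇒end μ (flat i) fg (sym ef))

  Near : Fin size → Fin size → Set
  Near e f = e ≡ f ⊎ e L.~ f

  ends-near : ∀ i s t → Near (end i s) (end i t)
  ends-near i A A = inj₁ refl
  ends-near i A C = inj₂ (proj₁ (flat i))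
  ends-near i C A = inj₂ (L.~-sym {end i A} {end i C} (proj₁ (flat i)))
  ends-near i C C = inj₁ refl

  adjacent⇒near : ∀ {v w} → v M.~ w → Near (base v) (base w)
  adjacent⇒near (G₀-G₀ p)         = inj₂ p
  adjacent⇒near (G₀-B p)          = inj₂ p
  adjacent⇒near (B-G₀ p)          = inj₂ p
  adjacent⇒near (B {i} {b} {c} _) = ends-near i (B.side i b) (B.side i c)
  adjacent⇒near (B-B _ p)         = inj₂ p

  -- Distinct vertices with equal bases lie in the same clique of one augment. Mates are excluded
  -- because an augment may lack some of its cross edges.
  near⇒adjacent : ∀ v w → v ≢ w → ¬ Mates (base v) (base w) → Near (base v) (base w) → v M.~ w
  near⇒adjacent (inj₁ u) (inj₁ v) v≢w ¬m (inj₁ p) = contradiction (cong inj₁ (value-injective p)) v≢w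
  near⇒adjacent (inj₁ u) (inj₁ v) v≢w ¬m (inj₂ p) = G₀-G₀ p
  near⇒adjacent (inj₁ u) (inj₂ (i , b)) v≢w ¬m (inj₁ p) = matched-absurd u i _ p
  near⇒adjacent (inj₁ u) (inj₂ (i , b)) v≢w ¬m (inj₂ p) = G₀-B p
  near⇒adjacent (inj₂ (i , b)) (inj₁ u) v≢w ¬m (inj₁ p) = matched-absurd u i _ (sym p)
  near⇒adjacent (inj₂ (i , b)) (inj₁ u) v≢w ¬m (inj₂ p) = B-G₀ p
  near⇒adjacent (inj₂ (i , b)) (inj₂ (j , c)) v≢w ¬m n with i ≟ j
  near⇒adjacent (inj₂ (i , b)) (inj₂ (j , c)) v≢w ¬m (inj₁ p) | no i≢j =
    contradiction (matching i j _ _ p) i≢j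
  near⇒adjacent (inj₂ (i , b)) (inj₂ (j , c)) v≢w ¬m (inj₂ p) | no i≢j = B-B i≢j p
  near⇒adjacent (inj₂ (i , b)) (inj₂ (j , c)) v≢w ¬m n | yes refl with B.side i b ≟ˢ B.side i c
  ... | yes s = B (B.cliques i b c s λ b≡c → v≢w (cong (λ b → inj₂ (i , b)) b≡c))
  ... | no ¬s = contradiction (ends⇒Mates i ¬s) ¬m

  private
    κ′ : Class
    κ′ = other κ

  -- Mates meet in `κ`; if they are parallel edges of `H` they also meet in `κ′`, and the second
  -- conjunct then keeps the cross pairs of their augment red.
  BlueType : Fin size → Fin size → Set
  BlueType e f = Meet κ′ e f × ¬ Mates e f

  blueType? : Decidable BlueType
  blueType? e f = (endIn κ′ e ≟ endIn κ′ f) ×-dec ¬? (mates? e f)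

  BlueType-sym : ∀ {e f} → BlueType e f → BlueType f e
  BlueType-sym (p , ¬m) = sym p , ¬m ∘ Mates-sym

  colouring : Colouring (augmented M)
  colouring = record
    { colour     = λ v w _ → hue (blueType? (base v) (base w))
    ; colour-sym = λ v w _ → hue-⇔ (blueType? (base v) (base w)) (blueType? (base w) (base v))
                               BlueType-sym BlueType-sym
    }

  blue⇒BlueType : ∀ {v w} → Edge colouring blue v w → BlueType (base v) (base w)
  blue⇒BlueType (_ , p) = hue-blue (blueType? _ _) p

  red⇒¬BlueType : ∀ {v w} → Edge colouring red v w → ¬ BlueType (base v) (base w)
  red⇒¬BlueType (_ , p) = hue-red (blueType? _ _) p

  red⇒Meet : ∀ {v w} → Edge colouring red v w → Meet κ (base v) (base w)
  red⇒Meet {v} {w} e = meet (mates? (base v) (base w)) (adjacent⇒near (proj₁ e))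
    where
    meet : Dec (Mates (base v) (base w)) → Near (base v) (base w) → Meet κ (base v) (base w)
    meet (yes m) _        = Mates⇒Meet m
    meet (no ¬m) (inj₁ p) = cong (endIn κ) p
    meet (no ¬m) (inj₂ p) =
      [ id , (λ q → contradiction (q , ¬m) (red⇒¬BlueType e)) ]′ (~⇒Meet κ p)

  meet⇒near : ∀ μ {e f} → Meet μ e f → Near e f
  meet⇒near μ {e} {f} m with e ≟ f
  ... | yes p = inj₁ p
  ... | no ¬p = inj₂ (Meet⇒~ μ ¬p m)

  -- If `e` and `g` were mates, `f` would equal one of them by `Mates-between`, making one of the
  -- two given pairs a pair of mates.
  BlueType-trans : ∀ {e f g} → BlueType e f → BlueType f g → BlueType e g
  BlueType-trans (ef , ¬ef) (fg , ¬fg) = trans ef fg , λ m → case Mates-between κ′ m ef fg of λ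
    { (inj₁ refl) → ¬fg m
    ; (inj₂ refl) → ¬ef m }

  blueType⇒adjacent : ∀ {v w} → v ≢ w → BlueType (base v) (base w) → v M.~ w
  blueType⇒adjacent v≢w (p , ¬m) = near⇒adjacent _ _ v≢w ¬m (meet⇒near κ′ p)

  good : Good blue colouring
  good = record { P₃-free = P₃-free ; K₃-free = λ uv vw uw →
    red⇒¬BlueType uw (BlueType-trans (blue⇒BlueType uv) (blue⇒BlueType vw)) }
    where
    P₃-free : ∀ l {u v w} → Edge colouring l u v → Edge colouring l v w → u ≢ w → u M.~ w
    P₃-free blue uv vw u≢w = blueType⇒adjacent u≢w
      (BlueType-trans (blue⇒BlueType uv) (blue⇒BlueType vw))
    P₃-free red {u} {v} {w} uv vw u≢w =
      near⇒adjacent u w u≢w ¬mates (meet⇒near κ (trans (red⇒Meet uv) (red⇒Meet vw)))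
      where
      -- Equal bases are of blue type, so a red pair has distinct bases. Hence the base of `v`
      -- cannot coincide with that of `u` or `w`, as it would have to if those were mates.
      base-≢ : ∀ {x y} → Edge colouring red x y → base x ≢ base y
      base-≢ xy eq = red⇒¬BlueType xy (cong (endIn κ′) eq , λ m → Mates⇒≢ m eq)

      ¬mates : ¬ Mates (base u) (base w)
      ¬mates m = [ base-≢ uv ∘ sym , base-≢ vw ]′ (Mates-between κ m (red⇒Meet uv) (red⇒Meet vw))

IsSkewAugmentation⇒AdmitsGood : IsSkewAugmentation G → AdmitsGood blue G
IsSkewAugmentation⇒AdmitsGood (H , M , skew , iso) = pull-Good iso ([ admits X , admits Y ]′ skew)
  where
  admits : ∀ κ → ClassAugmentation H κ M → AdmitsGood blue (augmented M)
  admits κ aug = SkewColouring.colouring H M κ aug , SkewColouring.good H M κ aug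

-- Decidable subsets and quotients of `Fin n`.

record Enumeration (P : Fin n → Set) : Set where
  field
    size           : ℕ
    elem           : Fin size → Fin n
    elem-∈         : ∀ i → P (elem i)
    elem-injective : ∀ {i j} → elem i ≡ elem j → i ≡ j
    index          : ∀ u → P u → Fin size
    elem-index     : ∀ u p → elem (index u p) ≡ u

abstract
  enumerate : {P : Fin n → Set} → U.Decidable P → Enumeration P
  enumerate {ℕ.zero} P? = record
    { size           = 0
    ; elem           = λ ()
    ; elem-∈         = λ ()
    ; elem-injective = λ {}
    ; index          = λ ()
    ; elem-index     = λ ()
    }
  enumerate {ℕ.suc n} P? with P? zero
  ... | yes p₀ = record
    { size           = ℕ.suc size
    ; elem           = λ { zero → zero ; (suc i) → suc (elem i) }
    ; elem-∈         = λ { zero → p₀ ; (suc i) → elem-∈ i }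
    ; elem-injective = λ { {zero} {zero} _ → refl
                         ; {suc _} {suc _} eq → cong suc (elem-injective (suc-injective eq)) }
    ; index          = λ { zero _ → zero ; (suc u) p → suc (index u p) }
    ; elem-index     = λ { zero _ → refl ; (suc u) p → cong suc (elem-index u p) }
    }
    where open Enumeration (enumerate (P? ∘ suc))
  ... | no ¬p₀ = record
    { size           = size
    ; elem           = suc ∘ elem
    ; elem-∈         = elem-∈
    ; elem-injective = elem-injective ∘ suc-injective
    ; index          = λ { zero p → contradiction p ¬p₀ ; (suc u) p → index u p }
    ; elem-index     = λ { zero p → contradiction p ¬p₀ ; (suc u) p → cong suc (elem-index u p) }
    }
    where open Enumeration (enumerate (P? ∘ suc))

least : {P : Fin n → Set} → U.Decidable P → ∃ P → Fin n
least {ℕ.suc n} P? (u , p) with P? zero | u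
... | yes _  | _     = zero
... | no ¬p₀ | zero  = contradiction p ¬p₀
... | no _   | suc v = suc (least (P? ∘ suc) (v , p))

least-∈ : {P : Fin n → Set} (P? : U.Decidable P) (w : ∃ P) → P (least P? w)
least-∈ {ℕ.suc n} P? (u , p) with P? zero | u
... | yes p₀ | _     = p₀
... | no ¬p₀ | zero  = contradiction p ¬p₀
... | no _   | suc v = least-∈ (P? ∘ suc) (v , p)

-- The least element depends only on which elements satisfy the predicate, not on the witness or the
-- decision procedure. This makes the least equivalent element a canonical representative.
least-cong : {P Q : Fin n → Set} (P? : U.Decidable P) (Q? : U.Decidable Q) (w : ∃ P) (w′ : ∃ Q) →
             (∀ u → P u → Q u) → (∀ u → Q u → P u) → least P? w ≡ least Q? w′
least-cong {ℕ.suc n} P? Q? (u , p) (v , q) f g with P? zero | Q? zero | u | v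
... | yes _  | yes _  | _     | _     = refl
... | yes p₀ | no ¬q₀ | _     | _     = contradiction (f zero p₀) ¬q₀
... | no ¬p₀ | yes q₀ | _     | _     = contradiction (g zero q₀) ¬p₀
... | no ¬p₀ | no _   | zero  | _     = contradiction p ¬p₀
... | no _   | no ¬q₀ | suc _ | zero  = contradiction q ¬q₀
... | no _   | no _   | suc u | suc v =
  cong suc (least-cong (P? ∘ suc) (Q? ∘ suc) (u , p) (v , q) (f ∘ suc) (g ∘ suc))

module Representative {_≈_ : Rel (Fin n) 0ℓ} (isDecEquivalence : IsDecEquivalence _≈_) where
  open IsDecEquivalence isDecEquivalence
    renaming (refl to ≈-refl; sym to ≈-sym; trans to ≈-trans; _≟_ to _≈?_)

  abstract
    rep : Fin n → Fin n
    rep u = least (u ≈?_) (u , ≈-refl)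

    rep-cong : ∀ {u v} → u ≈ v → rep u ≡ rep v
    rep-cong {u} {v} u≈v =
      least-cong (u ≈?_) (v ≈?_) _ _ (λ _ → ≈-trans (≈-sym u≈v)) (λ _ → ≈-trans u≈v)

    rep-injective : ∀ {u v} → rep u ≡ rep v → u ≈ v
    rep-injective {u} {v} eq = ≈-trans
      (subst (u ≈_) eq (least-∈ (u ≈?_) (u , ≈-refl))) (≈-sym (least-∈ (v ≈?_) (v , ≈-refl)))

-- Bipartite multigraphs given by two end maps.

module FromEnds {p q s : ℕ} (x : Fin s → Fin p) (y : Fin s → Fin q) where

  private
    class : Fin (p ℕ.+ q) → Class
    class v = [ const X , const Y ]′ (splitAt p v)

    class-X : ∀ i → class (i ↑ˡ q) ≡ X
    class-X i = cong [ const X , const Y ]′ (splitAt-↑ˡ p i q)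

    class-Y : ∀ j → class (p ↑ʳ j) ≡ Y
    class-Y j = cong [ const X , const Y ]′ (splitAt-↑ʳ p q j)

    X≢Y : ∀ {i j} → class (i ↑ˡ q) ≢ class (p ↑ʳ j)
    X≢Y {i} {j} eq = case trans (sym (class-X i)) (trans eq (class-Y j)) of λ ()

  -- The `p` vertices of class `X` come first, then the `q` of class `Y`. Values missed by `x` or
  -- `y` become isolated vertices, so the end maps may take values in a larger set than the classes
  -- they name.
  bipartiteMultigraph : BipartiteMultigraph
  bipartiteMultigraph = record
    { multigraph = record
      { order    = p ℕ.+ q
      ; size     = s
      ; ends     = λ e → x e ↑ˡ q , p ↑ʳ y e
      ; loopless = λ e → X≢Y ∘ cong class
      }
    ; class     = class
    ; bipartite = λ e → X≢Y
    }

  open BipartiteMultigraph bipartiteMultigraph using (multigraph; Incident)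
  open Graph (lineGraph multigraph)

  X-end : ∀ {e f} → x e ≡ x f → ∃[ v ] (class v ≡ X × Incident v e × Incident v f)
  X-end {e} eq = x e ↑ˡ q , class-X (x e) , inj₁ refl , inj₁ (cong (_↑ˡ q) eq)

  ~⇔ : ∀ {e f} → e ~ f ⇔ (e ≢ f × (x e ≡ x f ⊎ y e ≡ y f))
  ~⇔ {e} {f} = mk⇔
    (λ { (e≢f , v , inj₁ p , inj₁ q) → e≢f , inj₁ (↑ˡ-injective _ _ _ (trans (sym p) q))
       ; (e≢f , v , inj₂ p , inj₂ q) → e≢f , inj₂ (↑ʳ-injective _ _ _ (trans (sym p) q))
       ; (e≢f , v , inj₁ p , inj₂ q) → contradiction (cong class (trans (sym p) q)) X≢Y
       ; (e≢f , v , inj₂ p , inj₁ q) → contradiction (cong class (trans (sym q) p)) X≢Y })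
    (λ { (e≢f , inj₁ eq) → e≢f , x e ↑ˡ q , inj₁ refl , inj₁ (cong (_↑ˡ q) eq)
       ; (e≢f , inj₂ eq) → e≢f , p ↑ʳ y e , inj₂ refl , inj₂ (cong (p ↑ʳ_) eq) })

Side↔Fin2 : Side ↔ Fin 2
Side↔Fin2 = mk↔ₛ′ (λ { A → 0F ; C → 1F }) (λ { 0F → A ; 1F → C })
  (λ { 0F → refl ; 1F → refl }) (λ { A → refl ; C → refl })

-- Red and blue structure of a good colouring.

module RedBlue {G : Graph (Fin n)} (c : Colouring G) (good : Good blue c) where
  open Graph G
  open Good good

  Red Blue : Fin n → Fin n → Set
  Red  = Edge c red
  Blue = Edge c blue

  BlueEq : Fin n → Fin n → Set
  BlueEq u v = u ≡ v ⊎ Blue u v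

  BlueEq-trans : ∀ {u v w} → BlueEq u v → BlueEq v w → BlueEq u w
  BlueEq-trans (inj₁ refl) q           = q
  BlueEq-trans (inj₂ p)    (inj₁ refl) = inj₂ p
  BlueEq-trans {u} {v} {w} (inj₂ p) (inj₂ q) with u ≟ w
  ... | yes u≡w = inj₁ u≡w
  ... | no  u≢w with edge-either c blue (P₃-free blue p q u≢w)
  ...   | inj₁ b = inj₂ b
  ...   | inj₂ r = contradiction r (K₃-free p q)

  abstract
    BlueEq-isDecEquivalence : IsDecEquivalence BlueEq
    BlueEq-isDecEquivalence = record
      { isEquivalence = record
        { refl  = inj₁ refl
        ; sym   = Sum.map sym (Edge-sym c)
        ; trans = BlueEq-trans
        }
      ; _≟_ = λ u v → (u ≟ v) ⊎-dec edge? c blue u v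
      }

  InTriangle : Fin n → Set
  InTriangle u = ∃[ v ] ∃[ w ] (Red u v × Red v w × Red u w)

  abstract
    inTriangle? : U.Decidable InTriangle
    inTriangle? u = any? λ v → any? λ w → edge? c red u v ×-dec edge? c red v w ×-dec edge? c red u w

  -- Exactly two steps, not at most two: inside a red component with a triangle every red edge also
  -- has a red walk of length two, so one length serves for all connections.
  Red² : Fin n → Fin n → Set
  Red² u v = ∃[ w ] (Red u w × Red w v)

  red-red : ∀ {u v w} → Red u v → Red v w → u ≢ w → Red u w ⊎ Blue u w
  red-red p q u≢w = edge-either c red (P₃-free red p q u≢w)

  -- When `u` is neither `y` nor `z`, the pairs `u y` and `u z` are edges by `P₃-free`. If both were
  -- blue, the red edge `y z` would complete a forbidden triangle.
  red-edge-in-triangle : ∀ {u v} → InTriangle v → Red u v → Red² u v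
  red-edge-in-triangle {u} {v} (y , z , vy , yz , vz) uv with u ≟ y | u ≟ z
  ... | yes refl | _        = z , yz , Edge-sym c vz
  ... | no _     | yes refl = y , Edge-sym c yz , Edge-sym c vy
  ... | no u≢y   | no u≢z with red-red uv vy u≢y | red-red uv vz u≢z
  ...   | inj₁ uy | _       = y , uy , Edge-sym c vy
  ...   | inj₂ _  | inj₁ uz = z , uz , Edge-sym c vz
  ...   | inj₂ uy | inj₂ uz = contradiction yz (K₃-free (Edge-sym c uy) uz)

  InTriangle-resp : ∀ {u v} → Red u v → InTriangle v → InTriangle u
  InTriangle-resp {u} {v} uv t with red-edge-in-triangle t uv
  ... | w , uw , wv = w , v , uw , wv , uv

  -- A red chord shortens the walk at once. If both chords are blue, take a third vertex `q` of a
  -- red triangle on the edge from `p₀` to `p₁`: `K₃-free` forces `q p₂` red because of the blue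
  -- `p₀ p₂`, then `q p₃` red because of the blue `p₁ p₃`, and the walk passes through `q`.
  shorten : ∀ {p₀ p₁ p₂ p₃} → InTriangle p₀ → Red p₀ p₁ → Red p₁ p₂ → Red p₂ p₃ → Red² p₀ p₃
  shorten {p₀} {p₁} {p₂} {p₃} t e₀₁ e₁₂ e₂₃ with p₀ ≟ p₂ | p₁ ≟ p₃
  ... | yes refl | _        = red-edge-in-triangle (InTriangle-resp (Edge-sym c e₂₃) t) e₂₃
  ... | no _     | yes refl = red-edge-in-triangle (InTriangle-resp (Edge-sym c e₀₁) t) e₀₁
  ... | no p₀≢p₂ | no p₁≢p₃ with red-red e₀₁ e₁₂ p₀≢p₂ | red-red e₁₂ e₂₃ p₁≢p₃
  ...   | inj₁ e₀₂ | _        = p₂ , e₀₂ , e₂₃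
  ...   | inj₂ _   | inj₁ e₁₃ = p₁ , e₀₁ , e₁₃
  ...   | inj₂ b₀₂ | inj₂ b₁₃ = q , e₀q , eq₃
    where
    third = red-edge-in-triangle (InTriangle-resp (Edge-sym c e₀₁) t) e₀₁
    q   = proj₁ third
    e₀q : Red p₀ q
    e₀q = proj₁ (proj₂ third)
    eq₁ : Red q p₁
    eq₁ = proj₂ (proj₂ third)

    eq₂ : Red q p₂
    eq₂ with red-red eq₁ e₁₂ (λ { refl → Edge-opposite c e₀q b₀₂ })
    ... | inj₁ r = r
    ... | inj₂ b = contradiction e₀q (K₃-free b₀₂ (Edge-sym c b))

    eq₃ : Red q p₃
    eq₃ with red-red eq₂ e₂₃ (λ { refl → Edge-opposite c (Edge-sym c eq₁) b₁₃ })
    ... | inj₁ r = r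
    ... | inj₂ b = contradiction (Edge-sym c eq₁) (K₃-free b₁₃ (Edge-sym c b))

  -- On the vertices of red triangles, this is being joined by a red path
  -- (shorten reduces every such path to length two).

  TriangleEq : Fin n → Fin n → Set
  TriangleEq u v = u ≡ v ⊎ (InTriangle u × Red² u v)

  TriangleEq-sym : ∀ {u v} → TriangleEq u v → TriangleEq v u
  TriangleEq-sym (inj₁ p) = inj₁ (sym p)
  TriangleEq-sym (inj₂ (t , w , p , q)) = inj₂
    ( InTriangle-resp (Edge-sym c q) (InTriangle-resp (Edge-sym c p) t)
    , w , Edge-sym c q , Edge-sym c p )

  TriangleEq-trans : ∀ {u v w} → TriangleEq u v → TriangleEq v w → TriangleEq u w
  TriangleEq-trans (inj₁ refl) q           = q
  TriangleEq-trans (inj₂ p)    (inj₁ refl) = inj₂ p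
  TriangleEq-trans (inj₂ (t , _ , p , q)) (inj₂ (_ , _ , r , s)) with shorten t p q r
  ... | _ , p′ , q′ = inj₂ (t , shorten t p′ q′ s)

  abstract
    TriangleEq-isDecEquivalence : IsDecEquivalence TriangleEq
    TriangleEq-isDecEquivalence = record
      { isEquivalence = record
        { refl  = inj₁ refl
        ; sym   = TriangleEq-sym
        ; trans = TriangleEq-trans
        }
      ; _≟_ = λ u v → (u ≟ v) ⊎-dec
                      (inTriangle? u ×-dec any? λ w → edge? c red u w ×-dec edge? c red w v)
      }

  open Representative BlueEq-isDecEquivalence public using ()
    renaming (rep to blueClass; rep-cong to blueClass-cong; rep-injective to blueClass-injective)
  open Representative TriangleEq-isDecEquivalence public using ()
    renaming (rep to triangleClass; rep-cong to triangleClass-cong; rep-injective to triangleClass-injective)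

  red⇒blueClass-≢ : ∀ {u v} → Red u v → blueClass u ≢ blueClass v
  red⇒blueClass-≢ r eq with blueClass-injective eq
  ... | inj₁ u≡v = Edge⇒≢ c r u≡v
  ... | inj₂ b   = Edge-opposite c r b

  Linked : Fin n → Fin n → Set
  Linked β u = ¬ InTriangle u × ∃[ w ] (Red u w × blueClass w ≡ β)

  linked? : ∀ β → U.Decidable (Linked β)
  linked? β u = ¬? (inTriangle? u) ×-dec any? λ w → edge? c red u w ×-dec (blueClass w ≟ β)

  -- Two distinct red neighbours of `u` are adjacent; a red edge between them would put `u` in a red
  -- triangle, so they are joined by a blue edge.
  Linked-unique : ∀ {β γ u} → Linked β u → Linked γ u → β ≡ γ
  Linked-unique (¬t , v , p , refl) (_ , w , q , refl) with v ≟ w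
  ... | yes refl = refl
  ... | no v≢w with red-red (Edge-sym c p) q v≢w
  ...   | inj₁ r = contradiction (v , w , p , r , q) ¬t
  ...   | inj₂ b = blueClass-cong (inj₂ b)

  Member : Fin n × Fin n → Fin n → Set
  Member (α , β) u = (blueClass u ≡ α × Linked β u) ⊎ (blueClass u ≡ β × Linked α u)

  member? : ∀ p → U.Decidable (Member p)
  member? (α , β) u =
    ((blueClass u ≟ α) ×-dec linked? β u) ⊎-dec ((blueClass u ≟ β) ×-dec linked? α u)

  IsMember : Fin n → Set
  IsMember u = ¬ InTriangle u × ∃[ v ] Red u v

  isMember? : U.Decidable IsMember
  isMember? u = ¬? (inTriangle? u) ×-dec any? (edge? c red u)

  Member⇒IsMember : ∀ {p u} → Member p u → IsMember u
  Member⇒IsMember (inj₁ (_ , ¬t , w , r , _)) = ¬t , w , r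
  Member⇒IsMember (inj₂ (_ , ¬t , w , r , _)) = ¬t , w , r

  -- `Linked-unique` applied to the link through `v` itself puts `v` in the class `β`. The edge read
  -- backwards links `v` to the class of `u`.
  Linked-partner : ∀ {β u v} → Red u v → Linked β u → blueClass v ≡ β × Linked (blueClass u) v
  Linked-partner {v = v} r l@(¬t , _) =
    Linked-unique (¬t , v , r , refl) l , ¬t ∘ InTriangle-resp r , _ , Edge-sym c r , refl

  Member-red : ∀ {p u v} → Red u v → Member p u → Member p v
  Member-red r (inj₁ (refl , l)) = inj₂ (Linked-partner r l)
  Member-red r (inj₂ (refl , l)) = inj₁ (Linked-partner r l)

  -- Requiring `α < β` lists each unordered pair of blue classes once; the member supplies a cross
  -- edge of the augment.
  Block : Fin n × Fin n → Set
  Block (α , β) = α < β × ∃ (Member (α , β))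

  block? : U.Decidable Block
  block? (α , β) = (α <? β) ×-dec any? (member? (α , β))

  -- The blue class of `u` is one entry of each pair and `Linked-unique` determines the other. The
  -- mixed cases would give one pair in both orders.
  Member-unique : ∀ {p q u} → Block p → Block q → Member p u → Member q u → p ≡ q
  Member-unique _ _ (inj₁ (refl , l)) (inj₁ (refl , l′)) = cong₂ _,_ refl (Linked-unique l l′)
  Member-unique _ _ (inj₂ (refl , l)) (inj₂ (refl , l′)) = cong₂ _,_ (Linked-unique l l′) refl
  Member-unique (α<β , _) (γ<δ , _) (inj₁ (refl , l)) (inj₂ (refl , l′))
    with refl ← Linked-unique l l′ =
    contradiction γ<δ (<-asym α<β)
  Member-unique (α<β , _) (γ<δ , _) (inj₂ (refl , l)) (inj₁ (refl , l′))
    with refl ← Linked-unique l l′ =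
    contradiction γ<δ (<-asym α<β)

  IsMember⇒Block : ∀ {u} → IsMember u → ∃[ p ] (Block p × Member p u)
  IsMember⇒Block {u} (¬t , v , r) with <-cmp (blueClass u) (blueClass v)
  ... | tri< lt _ _ = let m = inj₁ (refl , ¬t , v , r , refl) in _ , (lt , u , m) , m
  ... | tri≈ _ eq _ = contradiction eq (red⇒blueClass-≢ r)
  ... | tri> _ _ gt = let m = inj₂ (refl , ¬t , v , r , refl) in _ , (gt , u , m) , m

-- Contraction of the blocks to flat edges.

module Contraction {G : Graph (Fin n)} (c : Colouring G) (good : Good blue c) where
  open Graph G
  open Good good
  open RedBlue c good

  abstract
    singles : Enumeration (λ u → ¬ IsMember u)
    singles = enumerate (λ u → ¬? (isMember? u))

    blocks : Enumeration (λ i → Block (remQuot n i))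
    blocks = enumerate (λ i → block? (remQuot n i))

    members : ∀ p → Enumeration (Member p)
    members p = enumerate (member? p)

  module Single    = Enumeration singles
  module Blocks    = Enumeration blocks
  module Members p = Enumeration (members p)

  pair : Fin Blocks.size → Fin n × Fin n
  pair i = remQuot n (Blocks.elem i)

  pair-injective : ∀ {i j} → pair i ≡ pair j → i ≡ j
  pair-injective eq = Blocks.elem-injective (Injection.injective (↔⇒↣ *↔×) eq)

  ends-of : Fin n × Fin n → Side → Fin n
  ends-of (α , β) A = α
  ends-of (α , β) C = β

  ends-of-injective : ∀ i {s t} → ends-of (pair i) s ≡ ends-of (pair i) t → s ≡ t
  ends-of-injective i {A} {A} _  = refl
  ends-of-injective i {A} {C} eq = contradiction eq (<⇒≢ (proj₁ (Blocks.elem-∈ i)))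
  ends-of-injective i {C} {A} eq = contradiction (sym eq) (<⇒≢ (proj₁ (Blocks.elem-∈ i)))
  ends-of-injective i {C} {C} _  = refl

  -- For a vertex in neither class, `C` is only a default value.
  sideIn : Fin n × Fin n → Fin n → Side
  sideIn (α , β) u with blueClass u ≟ α
  ... | yes _ = A
  ... | no  _ = C

  sideIn-correct : ∀ {p u} → Member p u → blueClass u ≡ ends-of p (sideIn p u)
  sideIn-correct {α , β} {u} m with blueClass u ≟ α | m
  ... | yes eq | _            = eq
  ... | no ¬eq | inj₁ (eq , _) = contradiction eq ¬eq
  ... | no _   | inj₂ (eq , _) = eq

  -- The edges of `H`: one for each vertex outside the blocks, and two for each block, to be the
  -- ends of its flat edge.
  Label : Set
  Label = Fin Single.size ⊎ (Fin Blocks.size × Side)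

  -- A single outside the red triangles is alone in its `triangleClass` and so has a private
  -- X-vertex. The X-vertex of a block carries just the two edges of that block.
  X-label : Label → Fin n ⊎ Fin Blocks.size
  X-label (inj₁ j)       = inj₁ (triangleClass (Single.elem j))
  X-label (inj₂ (i , _)) = inj₂ i

  Y-label : Label → Fin n
  Y-label (inj₁ j)       = blueClass (Single.elem j)
  Y-label (inj₂ (i , s)) = ends-of (pair i) s

  infix 4 _◂_ _∼_
  data _◂_ : Fin n → Label → Set where
    single : ∀ j → Single.elem j ◂ inj₁ j
    member : ∀ {i s u} → Member (pair i) u → blueClass u ≡ ends-of (pair i) s → u ◂ inj₂ (i , s)

  _∼_ : Label → Label → Set
  a ∼ b = a ≢ b × (X-label a ≡ X-label b ⊎ Y-label a ≡ Y-label b)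

  Member-block : ∀ {i j u} → Member (pair i) u → Member (pair j) u → i ≡ j
  Member-block {i} {j} m m′ = pair-injective (Member-unique (Blocks.elem-∈ i) (Blocks.elem-∈ j) m m′)

  ◂-functional : ∀ {u v a b} → u ≡ v → u ◂ a → v ◂ b → a ≡ b
  ◂-functional eq (single j) (single k) = cong inj₁ (Single.elem-injective eq)
  ◂-functional refl (single j) (member m _) = contradiction (Member⇒IsMember m) (Single.elem-∈ j)
  ◂-functional refl (member m _) (single j) = contradiction (Member⇒IsMember m) (Single.elem-∈ j)
  ◂-functional refl (member {i} m p) (member m′ q) with refl ← Member-block m m′ =
    cong (λ s → inj₂ (i , s)) (ends-of-injective i (trans (sym p) q))

  Y-label-correct : ∀ {u a} → u ◂ a → blueClass u ≡ Y-label a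
  Y-label-correct (single j)   = refl
  Y-label-correct (member _ p) = p

  -- Pairs to be set apart: inside a block, adjacency is read off the augment rather than off `H`.
  SameBlock : Label → Label → Set
  SameBlock a b = ∃[ i ] ∃[ s ] ∃[ t ] (a ≡ inj₂ (i , s) × b ≡ inj₂ (i , t))

  same-label : ∀ {u v a} → u ◂ a → v ◂ a → u ≡ v ⊎ SameBlock a a
  same-label (single j)         (single .j) = inj₁ refl
  same-label (member {i} {s} _ _) _          = inj₂ (i , s , s , refl , refl)

  -- Red edges never leave a block, by `Member-red`. A red edge between singles lies in a red
  -- component with a triangle, since otherwise its ends would be members.
  red-X : ∀ {u v a b} → u ◂ a → v ◂ b → ¬ SameBlock a b → Red u v → X-label a ≡ X-label b
  red-X (single j) (single k) _ r with inTriangle? (Single.elem k)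
  ... | yes t = cong inj₁ (triangleClass-cong (inj₂ (InTriangle-resp r t , red-edge-in-triangle t r)))
  ... | no ¬t = contradiction (¬t , _ , Edge-sym c r) (Single.elem-∈ k)
  red-X (single j) (member m _) _ r =
    contradiction (Member⇒IsMember (Member-red (Edge-sym c r) m)) (Single.elem-∈ j)
  red-X (member m _) (single j) _ r =
    contradiction (Member⇒IsMember (Member-red r m)) (Single.elem-∈ j)
  red-X (member m _) (member m′ _) _ r = cong inj₂ (Member-block (Member-red r m) m′)

  ~⇒∼ : ∀ {u v a b} → u ◂ a → v ◂ b → ¬ SameBlock a b → u ~ v → a ∼ b
  ~⇒∼ {u} {v} {a} {b} u◂a v◂b ¬same u~v = a≢b , meet (edge-either c red u~v)
    where
    a≢b : a ≢ b
    a≢b refl = [ (λ u≡v → ~-irrefl u≡v u~v) , ¬same ]′ (same-label u◂a v◂b)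

    meet : Red u v ⊎ Blue u v → X-label a ≡ X-label b ⊎ Y-label a ≡ Y-label b
    meet (inj₁ r) = inj₁ (red-X u◂a v◂b ¬same r)
    meet (inj₂ r) = inj₂ (trans (sym (Y-label-correct u◂a))
                          (trans (blueClass-cong (inj₂ r)) (Y-label-correct v◂b)))

  -- Equal Y-ends put `u` and `v` in one blue clique. Equal X-ends of two singles give a red walk of
  -- length two, which `P₃-free` closes to an edge.
  ∼⇒~ : ∀ {u v a b} → u ◂ a → v ◂ b → ¬ SameBlock a b → a ∼ b → u ~ v
  ∼⇒~ u◂a v◂b ¬same (a≢b , inj₂ eq)
    with blueClass-injective (trans (Y-label-correct u◂a) (trans eq (sym (Y-label-correct v◂b))))
  ... | inj₁ u≡v     = contradiction (◂-functional u≡v u◂a v◂b) a≢b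
  ... | inj₂ (p , _) = p
  ∼⇒~ (single j) (single k) ¬same (a≢b , inj₁ eq) with triangleClass-injective (inj₁-injective eq)
  ... | inj₁ u≡v             = contradiction (cong inj₁ (Single.elem-injective u≡v)) a≢b
  ... | inj₂ (_ , _ , p , q) =
    P₃-free red p q λ u≡v → a≢b (cong inj₁ (Single.elem-injective u≡v))
  ∼⇒~ (member {i} {s} _ _) (member {s = t} _ _) ¬same (a≢b , inj₁ refl) =
    contradiction (i , s , t , refl , refl) ¬same

  abstract
    Label↔ : Fin (Single.size ℕ.+ Blocks.size ℕ.* 2) ↔ Label
    Label↔ = ↔-trans +↔⊎ (↔-id _ ⊎-↔ ↔-trans *↔× (↔-id _ ×-↔ ↔-sym Side↔Fin2))

  open Inverse Label↔ using () renaming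
    (to to decode; from to encode; strictlyInverseˡ to decode-encode; strictlyInverseʳ to encode-decode)

  decode-injective : ∀ {e f} → decode e ≡ decode f → e ≡ f
  decode-injective = Injection.injective (↔⇒↣ Label↔)

  module H = FromEnds (λ e → join n Blocks.size (X-label (decode e))) (λ e → Y-label (decode e))

  open BipartiteMultigraph H.bipartiteMultigraph using (multigraph)
  module L = Graph (lineGraph multigraph)

  L~⇔∼ : ∀ {e f} → (e L.~ f) ⇔ (decode e ∼ decode f)
  L~⇔∼ = mk⇔
    (λ p → let e≢f , q = Equivalence.to H.~⇔ p in
      e≢f ∘ decode-injective , Sum.map₁ (Injection.injective (↔⇒↣ (↔-sym +↔⊎))) q)
    (λ (a≢b , q) → Equivalence.from H.~⇔
      (a≢b ∘ cong decode , Sum.map₁ (cong (join n Blocks.size)) q))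

  augmentOf : Fin Blocks.size → Augment
  augmentOf i = record
    { order     = size
    ; graph     = record
      { _~_      = λ b d → elem b ~ elem d
      ; ~-sym    = ~-sym
      ; ~-irrefl = λ b≡d → ~-irrefl (cong elem b≡d)
      ; _~?_     = λ b d → elem b ~? elem d
      }
    ; side      = side
    ; cliques   = cliques
    ; crossEdge = crossEdge
    }
    where
    open Members (pair i)

    side : Fin size → Side
    side b = sideIn (pair i) (elem b)

    cliques : ∀ b d → side b ≡ side d → b ≢ d → elem b ~ elem d
    cliques b d eq b≢d with blueClass-injective (trans (sideIn-correct (elem-∈ b))
                              (trans (cong (ends-of (pair i)) eq) (sym (sideIn-correct (elem-∈ d)))))
    ... | inj₁ p       = contradiction (elem-injective p) b≢d
    ... | inj₂ (p , _) = p

    side-index : ∀ {u s} (m : Member (pair i) u) →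
                 blueClass u ≡ ends-of (pair i) s → side (index u m) ≡ s
    side-index {u} m eq = ends-of-injective i (trans (sym (sideIn-correct (elem-∈ (index u m))))
                            (trans (cong blueClass (elem-index u m)) eq))

    edge : ∀ {u v} → blueClass u ≡ proj₁ (pair i) → Linked (proj₂ (pair i)) u → Red u v →
           ∃[ b ] ∃[ d ] (side b ≡ A × side d ≡ C × elem b ~ elem d)
    edge {u} {v} eq l r@(p , _) =
      let m = inj₁ (eq , l) ; m′ = Member-red r m in
      index u m , index v m′ , side-index m eq , side-index m′ (proj₁ (Linked-partner r l)) ,
      subst₂ _~_ (sym (elem-index u m)) (sym (elem-index v m′)) p

    crossEdge : ∃[ b ] ∃[ d ] (side b ≡ A × side d ≡ C × elem b ~ elem d)
    crossEdge with Blocks.elem-∈ i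
    ... | _ , u , inj₁ (eq , l@(_ , _ , r , _)) = edge eq l r
    -- The known member may lie on side `C`; its red partner then lies on side `A`, and the edge is
    -- reversed.
    ... | _ , u , inj₂ (eq , l@(_ , _ , r , _)) with Linked-partner r l
    ...   | eq′ , l′ = edge eq′ (subst (λ β → Linked β _) eq l′) (Edge-sym c r)

  M : Augmentation (lineGraph multigraph)
  M = record
    { k        = Blocks.size
    ; end      = end
    ; flat     = flat
    ; matching = λ i j s t eq →
        cong proj₁ (inj₂-injective (Injection.injective (↔⇒↣ (↔-sym Label↔)) eq))
    ; augment  = augmentOf
    }
    where
    end : Fin Blocks.size → Side → _
    end i s = encode (inj₂ (i , s))

    flat : ∀ i → Flat (lineGraph multigraph) (end i A) (end i C)
    flat i =
      Equivalence.from L~⇔∼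
        (subst₂ _∼_ (sym (decode-encode _)) (sym (decode-encode _)) ((λ ()) , inj₁ refl)) ,
      λ z (p , q) → noCommon (decode z)
        (subst (_∼ decode z) (decode-encode _) (Equivalence.to (L~⇔∼ {f = z}) p))
        (subst (_∼ decode z) (decode-encode _) (Equivalence.to (L~⇔∼ {f = z}) q))
      where
      -- Meeting both ends in Y would make the two blue classes of the block equal. Meeting either
      -- end in X makes `a` one of the two edges of the block, from both of which it is distinct.
      noCommon : ∀ a → inj₂ (i , A) ∼ a → ¬ inj₂ (i , C) ∼ a
      noCommon a (_ , inj₂ p) (_ , inj₂ q) = <⇒≢ (proj₁ (Blocks.elem-∈ i)) (trans p (sym q))
      noCommon (inj₂ (.i , A)) (a≢ , inj₁ refl) _ = a≢ refl
      noCommon (inj₂ (.i , C)) (_ , inj₁ refl) (c≢ , _) = c≢ refl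
      noCommon (inj₂ (.i , A)) (a≢ , _) (_ , inj₁ refl) = a≢ refl
      noCommon (inj₂ (.i , C)) _ (c≢ , inj₁ refl) = c≢ refl

  skew : Skew H.bipartiteMultigraph M
  skew = inj₁ λ i → H.X-end (cong (join n Blocks.size)
    (trans (cong X-label (decode-encode _)) (sym (cong X-label (decode-encode _)))))

  -- The isomorphism with the augmentation.

  open Augmentation M using (Vertex; Unmatched; module B)
  open Base M

  -- A label of a matched edge of H gets some vertex of its block, a junk value.

  fromLabel : Label → Fin n
  fromLabel (inj₁ j)       = Single.elem j
  fromLabel (inj₂ (i , _)) = proj₁ (proj₂ (Blocks.elem-∈ i))

  from : Vertex → Fin n
  from (inj₁ e)       = fromLabel (decode (value e))
  from (inj₂ (i , b)) = Members.elem (pair i) b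

  label : Vertex → Label
  label v = decode (base v)

  label-block : ∀ {Z : Set} e {i s} → label (inj₁ e) ≡ inj₂ (i , s) → Z
  label-block e {i} {s} eq = matched-absurd e i s (trans (sym (encode-decode _)) (cong encode eq))

  from-◂ : ∀ v → from v ◂ label v
  from-◂ (inj₁ e) with decode (value e) in eq
  ... | inj₁ j = single j
  -- An unmatched vertex never carries a block label, so the junk value of `fromLabel` is not
  -- reached.
  ... | inj₂ _ = label-block e eq
  from-◂ (inj₂ (i , b)) = subst (Members.elem (pair i) b ◂_) (sym (decode-encode _))
    (member (Members.elem-∈ (pair i) b) (sideIn-correct (Members.elem-∈ (pair i) b)))

  -- Equal images have equal labels by `◂-functional`. The label separates singles from members and
  -- determines the block, within which the enumeration is injective.
  from-injective : ∀ v w → from v ≡ from w → v ≡ w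
  from-injective v w eq = injective v w eq (◂-functional eq (from-◂ v) (from-◂ w))
    where
    injective : ∀ v w → from v ≡ from w → label v ≡ label w → v ≡ w
    injective (inj₁ e) (inj₁ f) _ p = cong inj₁ (value-injective (decode-injective p))
    injective (inj₁ e) (inj₂ _) _ p = label-block e (trans p (decode-encode _))
    injective (inj₂ _) (inj₁ f) _ p = label-block f (trans (sym p) (decode-encode _))
    injective (inj₂ (i , b)) (inj₂ (j , d)) q p
      with refl ← inj₂-injective (trans (sym (cong X-label (decode-encode _)))
                    (trans (cong X-label p) (cong X-label (decode-encode _)))) =
      cong (λ b → inj₂ (i , b)) (Members.elem-injective (pair i) q)

  to : ∀ u → ∃[ v ] from v ≡ u
  to u with isMember? u
  ... | no ¬m = inj₁ (encode (inj₁ j) ,ʳ [ unmatched ]) ,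
                trans (cong fromLabel (decode-encode _)) (Single.elem-index u ¬m)
    where
    j = Single.index u ¬m

    unmatched : Unmatched (encode (inj₁ j))
    unmatched i s eq = case trans (sym (decode-encode _)) (trans (cong decode eq) (decode-encode _)) of λ ()
  ... | yes m with IsMember⇒Block m
  ...   | p , b , u∈p = located (remQuot-combine (proj₁ p) (proj₂ p))
    where
    -- The code of the pair `p` below `n * n`; its block and member proofs are transported along
    -- `remQuot-combine`.
    k₀ = combine (proj₁ p) (proj₂ p)

    located : remQuot n k₀ ≡ p → ∃[ v ] from v ≡ u
    located eq = inj₂ (i , Members.index (pair i) u m′) , Members.elem-index (pair i) u m′
      where
      b′ = subst Block (sym eq) b
      i  = Blocks.index k₀ b′
      m′ : Member (pair i) u
      m′ = subst (λ p → Member p u)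
             (sym (trans (cong (remQuot n) (Blocks.elem-index k₀ b′)) eq)) u∈p

  from-~⇔ : ∀ v w → from v ~ from w ⇔ Adjacent M v w
  from-~⇔ v w = mk⇔ (⇒ v w) (⇐ v w)
    where
    spread : ∀ v w → ¬ SameBlock (label v) (label w) → from v ~ from w ⇔ base v L.~ base w
    spread v w ¬same = mk⇔
      (λ p → Equivalence.from L~⇔∼ (~⇒∼ (from-◂ v) (from-◂ w) ¬same p))
      (λ p → ∼⇒~ (from-◂ v) (from-◂ w) ¬same (Equivalence.to L~⇔∼ p))

    ¬sameˡ : ∀ e w → ¬ SameBlock (label (inj₁ e)) w
    ¬sameˡ e w (_ , _ , _ , eq , _) = label-block e eq

    ¬sameʳ : ∀ v e → ¬ SameBlock v (label (inj₁ e))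
    ¬sameʳ v e (_ , _ , _ , _ , eq) = label-block e eq

    ¬same : ∀ {i j b d} → i ≢ j → ¬ SameBlock (label (inj₂ (i , b))) (label (inj₂ (j , d)))
    ¬same i≢j (_ , _ , _ , p , q) = i≢j (trans
      (cong proj₁ (inj₂-injective (trans (sym (decode-encode _)) p)))
      (sym (cong proj₁ (inj₂-injective (trans (sym (decode-encode _)) q)))))

    ⇒ : ∀ v w → from v ~ from w → Adjacent M v w
    ⇒ (inj₁ e) (inj₁ f) p = G₀-G₀ (Equivalence.to (spread (inj₁ e) (inj₁ f) (¬sameˡ e _)) p)
    ⇒ (inj₁ e) (inj₂ w) p = G₀-B (Equivalence.to (spread (inj₁ e) (inj₂ w) (¬sameˡ e _)) p)
    ⇒ (inj₂ v) (inj₁ f) p = B-G₀ (Equivalence.to (spread (inj₂ v) (inj₁ f) (¬sameʳ _ f)) p)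
    ⇒ (inj₂ (i , b)) (inj₂ (j , d)) p with i ≟ j
    -- The augment inherits its adjacency from `G`, so `p` serves unchanged.
    ... | yes refl = B p
    ... | no i≢j   = B-B i≢j (Equivalence.to (spread (inj₂ (i , b)) (inj₂ (j , d)) (¬same i≢j)) p)

    ⇐ : ∀ v w → Adjacent M v w → from v ~ from w
    ⇐ _ _ (G₀-G₀ {e} {f} p)           = Equivalence.from (spread (inj₁ e) (inj₁ f) (¬sameˡ e _)) p
    ⇐ _ _ (G₀-B {e} p)                = Equivalence.from (spread (inj₁ e) (inj₂ _) (¬sameˡ e _)) p
    ⇐ _ _ (B-G₀ {v = f} p)            = Equivalence.from (spread (inj₂ _) (inj₁ f) (¬sameʳ _ f)) p
    ⇐ _ _ (B p)                       = p
    ⇐ _ _ (B-B i≢j p)                 = Equivalence.from (spread (inj₂ _) (inj₂ _) (¬same i≢j)) p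

  isomorphic : G ≅ augmented M
  isomorphic = record
    { bijection = mk↔ₛ′ (proj₁ ∘ to) from
        (λ v → from-injective _ _ (proj₂ (to (from v)))) (proj₂ ∘ to)
    ; adjacency = λ u v → subst₂ (λ x y → x ~ y ⇔ Adjacent M (proj₁ (to u)) (proj₁ (to v)))
                            (proj₂ (to u)) (proj₂ (to v)) (from-~⇔ (proj₁ (to u)) (proj₁ (to v)))
    }

-- The equivalences.

AdmitsGood⇒IsSkewAugmentation : {G : Graph (Fin n)} → AdmitsGood blue G → IsSkewAugmentation G
AdmitsGood⇒IsSkewAugmentation (c , good) =
  H.bipartiteMultigraph , M , skew , isomorphic
  where open Contraction c good

theorem23 : (n : ℕ) (G : Graph (Fin n)) →
    (AdmitsFree (ʳP₃ ∷ ᵇP₃ ∷ ʳʳᵇK₃ ∷ []) G ⇔ AdmitsFree (ʳP₃ ∷ ᵇP₃ ∷ ʳᵇᵇK₃ ∷ []) G)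
    × (AdmitsFree (ʳP₃ ∷ ᵇP₃ ∷ ʳᵇᵇK₃ ∷ []) G ⇔ IsSkewAugmentation G)
theorem23 n G =
  mk⇔ (from blue ∘ AdmitsGood-swap ∘ to red) (from red ∘ AdmitsGood-swap ∘ to blue) ,
  mk⇔ (AdmitsGood⇒IsSkewAugmentation ∘ to blue) (from blue ∘ IsSkewAugmentation⇒AdmitsGood)
  where
  to : ∀ k → AdmitsFree (ʳP₃ ∷ ᵇP₃ ∷ triangle k (opposite k) ∷ []) G → AdmitsGood k G
  to k = Equivalence.to AdmitsFree⇔AdmitsGood

  from : ∀ k → AdmitsGood k G → AdmitsFree (ʳP₃ ∷ ᵇP₃ ∷ triangle k (opposite k) ∷ []) G
  from k = Equivalence.from AdmitsFree⇔AdmitsGood
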